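{- For every infinite compact topological space $Y$, the relation $\omega^{*}\rightarrow(Y)^{1}_{2}$ fails.
   Context: $\omega$ is the countably infinite discrete space, $\beta(\omega)$ its Stone-Čech compactification, and $\omega^{*}=\beta(\omega)\setminus\omega$ with the subspace topology. For topological spaces $X,Y$, the relation $X\rightarrow(Y)^{1}_{2}$ means: whenever $X=P_0\cup P_1$, there are $i\in\{0,1\}$ and $Y'\subseteq P_i$ such that $Y'$ (with the subspace topology from $X$) is homeomorphic to $Y$. -}

module Defs where

open import Data.Fin.Base using (Fin)
open import Data.List.Base using (List)
open import Data.List.Relation.Unary.Any using (Any)
open import Data.List.Relation.Unary.Enumerates.Setoid using (IsEnumeration)
open import Data.Nat.Base using (ℕ)
open import Data.Product.Base using (Σ; _×_; _,_; proj₁; proj₂; ∃; ∃-syntax)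
open import Data.Unit.Polymorphic.Base using (⊤; tt)
open import Function.Base using (_on_)
open import Function.Bundles using (Func; Inverse)
open import Function.Definitions using (Injective)
open import Level using (Level; 0ℓ; suc; _⊔_)
open import Relation.Binary.Bundles using (Setoid)
open import Relation.Binary.Core using (REL)
open import Relation.Binary.Definitions using (_Respects_; _Respectsˡ_; _Respectsʳ_)
import Relation.Binary.Construct.On as On
import Relation.Binary.PropositionalEquality as ≡
open import Relation.Nullary.Negation using (¬_)
open import Relation.Unary
  using (Pred; _∈_; _⊆_; _≐_; _∩_; _⊢_; _⊥_; ⋃; Satisfiable)

private
  variable
    a ℓ o ℓ′ o′ : Level

-- Zermelo's axiom of choice.  Since the choice function must respect the
-- setoid equalities, this is not the type-theoretic "choice" that is provable
-- for Σ; it implies excluded middle by Diaconescu's argument.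
AxiomOfChoice : ∀ a → Set (suc a)
AxiomOfChoice a =
  (A B : Setoid a a) (R : REL (Setoid.Carrier A) (Setoid.Carrier B) a) →
  R Respectsˡ Setoid._≈_ A →
  R Respectsʳ Setoid._≈_ B →
  (∀ x → ∃[ y ] R x y) →
  ∃[ f ] (∀ x → R x (Func.to {From = A} {To = B} f x))

-- Points form a setoid, and subsets are predicates respecting its equality.
-- Unions are indexed by types in the universe of the points; this loses
-- nothing, because a union of any family is also the union of a subfamily
-- indexed by its own elements.  The empty set is open as the union of the
-- empty family.
record Space (ℓ o : Level) : Set (suc (ℓ ⊔ o)) where
  field
    setoid : Setoid ℓ ℓ

  open Setoid setoid public

  field
    Open          : Pred Carrier ℓ → Set o
    open-respects : ∀ {U} → Open U → U Respects _≈_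
    open-≐        : ∀ {U V} → U ≐ V → Open U → Open V
    open-⊤        : Open (λ _ → ⊤)
    open-∩        : ∀ {U V} → Open U → Open V → Open (U ∩ V)
    open-⋃        : ∀ {I : Set ℓ} (F : I → Pred Carrier ℓ) →
                    (∀ i → Open (F i)) → Open (⋃ I F)

open Space using (setoid; Carrier; Open)

record Subset (X : Space ℓ o) : Set (suc ℓ) where
  open Space X using (_≈_)
  field
    pred     : Pred (Carrier X) ℓ
    respects : pred Respects _≈_

open Subset using (pred)

subspace : (X : Space ℓ o) → Subset X → Space ℓ (suc ℓ ⊔ o)
subspace {ℓ} X S = record
  { setoid        = On.setoid {B = Σ X.Carrier (pred S)} X.setoid proj₁
  ; Open          = λ U → ∃[ V ] (X.Open V × U ≐ (proj₁ ⊢ V))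
  ; open-respects = λ (V , oV , (U⊆V , V⊆U)) x≈y x∈U →
                      V⊆U (X.open-respects oV x≈y (U⊆V x∈U))
  ; open-≐        = λ (U⊆U′ , U′⊆U) (V , oV , (U⊆V , V⊆U)) →
                      V , oV , ((λ x∈ → U⊆V (U′⊆U x∈)) , (λ x∈ → U⊆U′ (V⊆U x∈)))
  ; open-⊤        = (λ _ → ⊤) , X.open-⊤ , ((λ _ → tt) , (λ _ → tt))
  ; open-∩        = λ (V , oV , (U⊆V , V⊆U)) (V′ , oV′ , (U′⊆V′ , V′⊆U′)) →
                      (V ∩ V′) , X.open-∩ oV oV′ ,
                      ( (λ (x∈U , x∈U′) → U⊆V x∈U , U′⊆V′ x∈U′)
                      , (λ (x∈V , x∈V′) → V⊆U x∈V , V′⊆U′ x∈V′))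
  ; open-⋃        = λ {I} F oF →
                      ⋃ I (λ i → proj₁ (oF i)) ,
                      X.open-⋃ (λ i → proj₁ (oF i)) (λ i → proj₁ (proj₂ (oF i))) ,
                      ( (λ (i , x∈) → i , proj₁ (proj₂ (proj₂ (oF i))) x∈)
                      , (λ (i , x∈) → i , proj₂ (proj₂ (proj₂ (oF i))) x∈))
  }
  where module X = Space X

-- The preimage f ⊢ V lives in the universe of the codomain, so its openness is
-- expressed through the predicates U on the domain with the same elements.
-- Such a U always exists classically.
Continuous : (X : Space ℓ o) (Y : Space ℓ′ o′) → (Carrier X → Carrier Y) → Set _
Continuous {ℓ = ℓ} X Y f =
  ∀ {V} → Open Y V → ∀ {U : Pred (Carrier X) ℓ} → U ≐ (f ⊢ V) → Open X U

record Homeomorphism (X : Space ℓ o) (Y : Space ℓ′ o′)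
       : Set (suc (ℓ ⊔ ℓ′) ⊔ o ⊔ o′) where
  field
    inverse : Inverse (setoid X) (setoid Y)

  open Inverse inverse public

  field
    to-continuous   : Continuous X Y to
    from-continuous : Continuous Y X from

-- As for unions, covers indexed by the universe of the points suffice.
Compact : Space ℓ o → Set _
Compact {ℓ} X =
  ∀ {I : Set ℓ} (F : I → Pred (Carrier X) ℓ) →
  (∀ i → Open X (F i)) →
  (∀ x → ∃[ i ] x ∈ F i) →
  ∃[ is ] (∀ x → Any (λ i → x ∈ F i) is)

Hausdorff : Space ℓ o → Set _
Hausdorff X =
  ∀ {x y} → ¬ (Space._≈_ X x y) →
  ∃[ U ] ∃[ V ] (Open X U × Open X V × x ∈ U × y ∈ V × U ⊥ V)

Infinite : Space ℓ o → Set ℓ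
Infinite X = ¬ (∃[ xs ] IsEnumeration (setoid X) xs)

record IsDenseEmbedding (X : Space ℓ o) (Y : Space ℓ′ o′)
       (e : Func (setoid X) (setoid Y)) : Set (suc (ℓ ⊔ ℓ′) ⊔ o ⊔ o′) where
  open Func e using (to)
  field
    injective  : Injective (Space._≈_ X) (Space._≈_ Y) to
    continuous : Continuous X Y to
    induced    : ∀ {U} → Open X U → ∃[ V ] (Open Y V × U ≐ (to ⊢ V))
    dense      : ∀ {V} → Open Y V → Satisfiable V → ∃[ x ] to x ∈ V

-- A compact Hausdorff space containing X densely, to which every continuous map
-- from X to a compact Hausdorff space extends; this determines it up to
-- homeomorphism over X.
record StoneČechCompactification (X : Space ℓ o) : Set (suc (ℓ ⊔ o)) where
  field
    β         : Space ℓ o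
    compact   : Compact β
    hausdorff : Hausdorff β
    ι         : Func (setoid X) (setoid β)
    embedding : IsDenseEmbedding X β ι
    extend    : (K : Space ℓ o) → Compact K → Hausdorff K →
                (f : Func (setoid X) (setoid K)) → Continuous X K (Func.to f) →
                ∃[ g ] (Continuous β K (Func.to {From = setoid β} {To = setoid K} g) ×
                        (∀ x → Space._≈_ K (Func.to g (Func.to ι x)) (Func.to f x)))

  remainder : Space ℓ (suc ℓ ⊔ o)
  remainder = subspace β record
    { pred     = λ b → ¬ (∃[ x ] Func.to ι x ≈ b)
    ; respects = λ b≈c b∉ (x , ιx≈c) → b∉ (x , trans ιx≈c (sym b≈c))
    }
    where open Space β using (_≈_; sym; trans)

ω : Space 0ℓ 0ℓ
ω = record
  { setoid        = ≡.setoid ℕ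
  ; Open          = λ _ → ⊤
  ; open-respects = λ {U} _ → ≡.subst U
  ; open-≐        = _
  ; open-⊤        = _
  ; open-∩        = _
  ; open-⋃        = _
  }

-- The arrow relation X → (Y)¹₂.
_⟶⟨_⟩¹₂ : Space ℓ o → Space ℓ′ o′ → Set _
X ⟶⟨ Y ⟩¹₂ =
  (P : Fin 2 → Subset X) → (∀ x → ∃[ i ] x ∈ pred (P i)) →
  ∃[ i ] ∃[ Y′ ] (pred Y′ ⊆ pred (P i) × Homeomorphism (subspace X Y′) Y)

{-# OPTIONS --safe #-}

-- The colouring is a Bernstein set for the closed subsets of βω.  A closed set is
-- determined by the clopen sets containing it, so there are at most 2^2^ω of
-- them.  An infinite closed set has at least 2^2^ω points: split off points x₀,
-- x₁, … along a decreasing sequence of clopen sets, and spread an independent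
-- family of 2^ω subsets of ω over the differences; by compactness every pattern
-- of membership in these sets is realised by a point.  Hence one can choose,
-- without repetition, a black and a white point in every infinite closed set.
-- A copy of Y is such a set, so it is not contained in a single colour.
module Submission where

open import Axiom.ExcludedMiddle using (ExcludedMiddle)
open import Data.Bool.Base using (Bool; true; false; not; _∧_; _∨_; _xor_; if_then_else_)
open import Data.Bool.Properties using (_≟_; ¬-not; not-¬; ⇔→≡; ∧-conicalˡ; ∨-zeroʳ;
  xor-same; not-distribˡ-xor)
open import Data.Fin.Base using (Fin; zero; suc)
open import Data.Irrelevant using () renaming ([_] to irrelevant)
open import Data.List.Base using (List; []; _∷_; _++_; foldr; map; applyUpTo)
open import Data.List.Relation.Unary.Any as Any using (Any; here; there)
open import Data.List.Membership.Propositional using (find) renaming (_∈_ to _∈ₗ_)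
import Data.List.Properties as List
import Data.List.Relation.Unary.Any.Properties as Any
open import Data.Maybe.Base using (Maybe; just; nothing; maybe′)
open import Data.Maybe.Properties using (just-injective)
open import Data.Nat.Base as ℕ using (ℕ; zero; suc; s≤s; _⊔_; _≤′_; ≤′-refl; ≤′-step)
open import Data.Nat.Binary.Base as ℕᵇ using (ℕᵇ; 2[1+_]; 1+[2_])
import Data.Nat.Binary.Properties as ℕᵇ
open import Data.Nat.Properties using (m≤m⊔n; m≤n⊔m; ≤-trans; <-cmp; ≤⇒≤′)
open import Data.Product.Base using (Σ; ∃; ∃-syntax; _×_; _,_; proj₁; proj₂)
open import Data.Product.Properties using (,-injectiveʳ)
open import Data.Refinement.Base using (Refinement; value; _,_)
open import Data.Sum.Base using (_⊎_; inj₁; inj₂; [_,_]′)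
open import Data.Unit.Polymorphic.Base using (⊤)
open import Function.Base using (_∘_; id; _on_)
open import Function.Bundles using (Func; mk⇔)
open import Function.Definitions using (Injective)
open import Induction.WellFounded using (WellFounded; Acc; acc; WfRec; module All; module FixPoint)
open import Level using (Level; Lift; lift; lower; 0ℓ) renaming (_⊔_ to _⊔ₗ_)
open import Relation.Binary.Bundles using (Setoid)
open import Relation.Binary.Core using (Rel)
open import Relation.Binary.Definitions using (tri<; tri≈; tri>)
import Relation.Binary.Construct.On as On
open import Relation.Binary.PropositionalEquality as ≡
  using (_≡_; _≢_; _≗_; _→-setoid_; refl; cong; subst)
open import Relation.Nullary.Decidable
  using (Dec; yes; no; does; True; toWitness; fromWitness; decidable-stable; recompute; dec-true)
open import Relation.Nullary.Negation using (¬_; contradiction)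
open import Relation.Unary using (Pred; _∈_; _⊆_; _≐_; ∁; ⋃; Satisfiable)

open import Defs

private
  variable
    a : Level

-- Consequences of choice: excluded middle, choice functions, quotients.

module Choice (ac : ∀ {a} → AxiomOfChoice a) where

  -- Diaconescu: a choice function on Bool modulo "true ~ false iff P" decides P.
  diaconescu : ExcludedMiddle a
  diaconescu {a} {P} = decide (f true′ L≟ f false′)
    where
    open import Relation.Binary.PropositionalEquality using (sym; trans)
    true′ false′ : Lift a Bool
    true′  = lift true
    false′ = lift false

    _∼_ : Rel (Lift a Bool) a
    x ∼ y = x ≡ y ⊎ P

    Bool/P : Setoid a a
    Bool/P = record
      { _≈_ = _∼_
      ; isEquivalence = record
        { refl  = inj₁ refl
        ; sym   = [ inj₁ ∘ sym , inj₂ ]′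
        ; trans = λ { (inj₁ p) (inj₁ q) → inj₁ (trans p q)
                    ; (inj₂ p) _        → inj₂ p
                    ; _        (inj₂ q) → inj₂ q }
        }
      }

    chosen = ac Bool/P (≡.setoid (Lift a Bool)) _∼_
      (λ { (inj₁ refl) r → r ; (inj₂ p) _ → inj₂ p })
      (λ { refl r → r }) (λ x → x , inj₁ refl)
    f = Func.to (proj₁ chosen)

    _L≟_ : (x y : Lift a Bool) → Dec (x ≡ y)
    lift x L≟ lift y with x ≟ y
    ... | yes refl = yes refl
    ... | no  x≢y  = no λ { refl → x≢y refl }

    decide : Dec (f true′ ≡ f false′) → Dec P
    decide (no  ft≢ff) = no λ p → ft≢ff (Func.cong (proj₁ chosen) (inj₂ p))
    decide (yes ft≡ff) with proj₂ chosen true′ | proj₂ chosen false′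
    ... | inj₂ p | _      = yes p
    ... | _      | inj₂ p = yes p
    ... | inj₁ t | inj₁ u with () ← trans t (trans ft≡ff (sym u))

  abstract
    em : ExcludedMiddle a
    em = diaconescu

  stable : {P : Set a} → ¬ ¬ P → P
  stable = decidable-stable em

  ¬∀⇒∃¬ : ∀ {b} {A : Set a} {P : Pred A b} → ¬ (∀ x → x ∈ P) → ∃[ x ] ¬ (x ∈ P)
  ¬∀⇒∃¬ ¬∀ = stable λ ¬∃ → ¬∀ λ x → stable λ x∉P → ¬∃ (x , x∉P)

  ⌊_⌋ : Set a → Bool
  ⌊ P ⌋ = does (em {P = P})

  ⌊⌋-sound : {P : Set a} → ⌊ P ⌋ ≡ true → P
  ⌊⌋-sound {P = P} eq with em {P = P}
  ... | yes p = p

  ⌊⌋-complete : {P : Set a} → P → ⌊ P ⌋ ≡ true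
  ⌊⌋-complete = dec-true em

  ⌊⌋-unsound : {P : Set a} → ⌊ P ⌋ ≡ false → ¬ P
  ⌊⌋-unsound eq p with () ← ≡.trans (≡.sym eq) (⌊⌋-complete p)

  Chosen : {A : Set} → Pred A 0ℓ → Maybe A → Set
  Chosen P = maybe′ P (¬ Satisfiable P)

  ChoiceFunction : Set → Set₁
  ChoiceFunction A = Σ (Pred A 0ℓ → Maybe A) λ choose →
    (∀ {P Q} → P ≐ Q → choose P ≡ choose Q) × (∀ P → Chosen P (choose P))

  -- The axiom is applied to the setoid of subsets under mutual inclusion; answering `nothing` on
  -- the empty subset makes the relation total.
  choiceFunction : (A : Set) → ChoiceFunction A
  choiceFunction A = (λ P → lower (Func.to f P))
           , (λ P≐Q → cong lower (Func.cong f (lift P≐Q)))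
           , (λ P → lower (proj₂ f-chosen P))
    where
    subsets : Setoid _ _
    subsets = record
      { Carrier = Pred A 0ℓ
      ; _≈_ = λ P Q → Lift _ (P ≐ Q)
      ; isEquivalence = record
        { refl  = lift (id , id)
        ; sym   = λ (lift (p , q)) → lift (q , p)
        ; trans = λ (lift (p , q)) (lift (r , s)) → lift (r ∘ p , q ∘ s)
        }
      }

    transfer : ∀ {P Q} m → P ≐ Q → Chosen P m → Chosen Q m
    transfer (just x) (P⊆Q , _)   = P⊆Q
    transfer nothing  (_   , Q⊆P) = λ ¬P (x , x∈Q) → ¬P (x , Q⊆P x∈Q)

    total : ∀ P → ∃ (Chosen P)
    total P with em {P = Satisfiable P}
    ... | yes (x , x∈P) = just x , x∈P
    ... | no  ¬P        = nothing , ¬P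

    f-chosen = ac subsets (≡.setoid (Lift _ (Maybe A))) (λ P m → Lift _ (Chosen P (lower m)))
      (λ { {m} (lift P≐Q) (lift c) → lift (transfer (lower m) P≐Q c) }) (λ { refl c → c })
      (λ P → lift (proj₁ (total P)) , lift (proj₂ (total P)))
    f = proj₁ f-chosen

  abstract
    choice : (A : Set) → ChoiceFunction A
    choice = choiceFunction

  -- Turns setoid equality into `_≡_` by keeping only canonical representatives, so that functions
  -- under pointwise equality can be counted and well-ordered as a plain type.
  module Quotient (S : Setoid 0ℓ 0ℓ) where
    open Setoid S using (Carrier; _≈_; sym; trans)

    private
      canonical = ac S (≡.setoid Carrier) _≈_ (λ x≈y x≈z → trans (sym x≈y) x≈z)
        (λ { refl r → r }) (λ x → x , Setoid.refl S)
      canon = Func.to (proj₁ canonical)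

    Quotient : Set
    Quotient = Refinement Carrier λ x → canon x ≡ x

    [_] : Carrier → Quotient
    [ x ] = canon x , irrelevant (≡.sym (Func.cong (proj₁ canonical) (proj₂ canonical x)))

    rep : Quotient → Carrier
    rep = value

    rep-[] : ∀ x → rep [ x ] ≈ x
    rep-[] x = sym (proj₂ canonical x)

    rep-injective : ∀ {p q} → rep p ≈ rep q → p ≡ q
    rep-injective {x , irrelevant p} {y , irrelevant q} x≈y = value-injective
      (≡.trans (≡.sym (recompute em p)) (≡.trans (Func.cong (proj₁ canonical) x≈y) (recompute em q)))
      where
      value-injective : {p q : Quotient} → value p ≡ value q → p ≡ q
      value-injective refl = refl

  -- Well-orderings of initial order type.

  -- Zermelo: the tower generated by unions and S ↦ S ∪ {choose (∁ S)} is a chain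
  -- under inclusion, and x < y means that some member contains x but not y.
  module WellOrder (A : Set) where

    private
      choose = proj₁ (choice A)
      choose-cong = proj₁ (proj₂ (choice A))
      choose-chosen = proj₂ (proj₂ (choice A))

      _⁺ : Pred A 0ℓ → Pred A 0ℓ
      (S ⁺) x = x ∈ S ⊎ choose (∁ S) ≡ just x

      ⁺-cong : ∀ {S T} → S ⊆ T → T ⊆ S → S ⁺ ⊆ T ⁺
      ⁺-cong S⊆T T⊆S (inj₁ x∈S) = inj₁ (S⊆T x∈S)
      ⁺-cong S⊆T T⊆S (inj₂ eq)  =
        inj₂ (≡.trans (choose-cong ((λ x∉T x∈S → x∉T (S⊆T x∈S)) , (λ x∉S x∈T → x∉S (T⊆S x∈T)))) eq)

      data Tower : Pred A 0ℓ → Set₁ where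
        step  : ∀ {S} → Tower S → Tower (S ⁺)
        union : {I : Set} (F : I → Pred A 0ℓ) → (∀ i → Tower (F i)) → Tower (⋃ I F)

      -- The strong alternative `T ⁺ ⊆ S` carries the induction. At a step with `S ⊆ T`, comparing
      -- the other way round leaves only `T ⊆ S`, where the successors coincide, or `S ⁺ ⊆ T`.
      compare : ∀ {S T} → Tower S → Tower T → S ⊆ T ⊎ T ⁺ ⊆ S
      compare (step s) t with compare s t
      ... | inj₂ T⁺⊆S = inj₂ (inj₁ ∘ T⁺⊆S)
      ... | inj₁ S⊆T with compare t s
      ...   | inj₁ T⊆S  = inj₂ (⁺-cong T⊆S S⊆T)
      ...   | inj₂ S⁺⊆T = inj₁ S⁺⊆T
      compare {T = T} (union F f) t with em {P = ∀ i → F i ⊆ T}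
      ... | yes F⊆T = inj₁ λ (i , x∈Fi) → F⊆T i x∈Fi
      ... | no  F⊈T with ¬∀⇒∃¬ F⊈T
      ...   | i , Fi⊈T with compare (f i) t
      ...     | inj₁ Fi⊆T  = contradiction (λ {_} → Fi⊆T) Fi⊈T
      ...     | inj₂ T⁺⊆Fi = inj₂ λ x∈T⁺ → i , T⁺⊆Fi x∈T⁺

      Separates : A → A → Pred A 0ℓ → Set₁
      Separates a x T = Tower T × ¬ (a ∈ T) × x ∈ T

      -- The largest member of the tower that omits a.
      module Below (a : A) where
        Index : Set
        -- The tower lives in `Set₁`; `True` of a decision is small enough to index a union.
        Index = Σ A λ x → True (em {P = ∃ (Separates a x)})

        family : Index → Pred A 0ℓ
        family (_ , w) = proj₁ (toWitness w)

      below : A → Pred A 0ℓ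
      below a = ⋃ (Below.Index a) (Below.family a)

      below-tower : ∀ a → Tower (below a)
      below-tower a = union _ λ (_ , w) → proj₁ (proj₂ (toWitness w))

      below-omits : ∀ a → ¬ (a ∈ below a)
      below-omits a ((_ , w) , a∈) = proj₁ (proj₂ (proj₂ (toWitness w))) a∈

      below-largest : ∀ {a T} → Tower T → ¬ (a ∈ T) → T ⊆ below a
      below-largest t a∉T {x} x∈T =
        (x , w) , proj₂ (proj₂ (proj₂ (toWitness w)))
        where w = fromWitness (_ , t , a∉T , x∈T)

      -- Otherwise the successor of `below a` still omits `a` and is contained in `below a` by
      -- maximality, although the nonempty complement always supplies a new element.
      choose-below : ∀ a → choose (∁ (below a)) ≡ just a
      choose-below a = stable λ ≢a → below-advances
        (below-largest (step (below-tower a)) [ below-omits a , ≢a ]′)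
        where
        below-advances : ¬ (below a ⁺ ⊆ below a)
        below-advances ⊆ with choose (∁ (below a)) in eq | choose-chosen (∁ (below a))
        ... | just x  | x∉ = x∉ (⊆ (inj₂ refl))
        ... | nothing | ∅  = ∅ (a , below-omits a)

    _<_ : Rel A 0ℓ
    x < y = x ∈ below y

    <-tri : ∀ x y → x < y ⊎ x ≡ y ⊎ y < x
    <-tri x y with compare (below-tower x) (below-tower y) | compare (below-tower y) (below-tower x)
    ... | inj₂ y⁺⊆x | _         = inj₂ (inj₂ (y⁺⊆x (inj₂ (choose-below y))))
    ... | inj₁ _    | inj₂ x⁺⊆y = inj₁ (x⁺⊆y (inj₂ (choose-below x)))
    ... | inj₁ x⊆y  | inj₁ y⊆x  = inj₂ (inj₁ (just-injective
      (≡.trans (≡.sym (choose-below x))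
        (≡.trans (choose-cong ((λ ∉x ∈y → ∉x (y⊆x ∈y)) , (λ ∉y ∈x → ∉y (x⊆y ∈x)))) (choose-below y)))))

    private
      -- An element `x` added to `S` has all its predecessors in `S`: the alternative in `compare`
      -- puts `x` itself into `below x`.
      tower-acc : ∀ {S} → Tower S → S ⊆ Acc _<_
      tower-acc (step s) (inj₁ x∈S) = tower-acc s x∈S
      tower-acc (step {S} s) {x} (inj₂ eq) = acc λ y<x → tower-acc s (below⊆S y<x)
        where
        below⊆S : below x ⊆ S
        below⊆S with compare (below-tower x) s
        ... | inj₁ ⊆S = ⊆S
        ... | inj₂ S⁺⊆ = contradiction (S⁺⊆ (inj₂ eq)) (below-omits x)
      tower-acc (union F f) (i , x∈) = tower-acc (f i) x∈

    <-wellFounded : WellFounded _<_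
    <-wellFounded x = tower-acc (step (below-tower x)) (inj₂ (choose-below x))

  -- The field `initial` says that the order type is an initial ordinal: no proper initial segment
  -- has the size of the whole.
  record InitialWellOrder (A : Set) : Set₁ where
    field
      _<_         : Rel A 0ℓ
      wellFounded : WellFounded _<_
      tri         : ∀ x y → x < y ⊎ x ≡ y ⊎ y < x
      initial     : ∀ x → ¬ (∃[ h ] (Injective {A = A} _≡_ _≡_ h × (∀ y → h y < x)))

  -- If A embeds below some point, transport the order along an embedding below
  -- the least such point.
  transportedWellOrder : (A : Set) → InitialWellOrder A
  transportedWellOrder A with em {P = ∃ λ x → ∃[ h ] (Injective {A = A} _≡_ _≡_ h × (∀ y → h y < x))}
    where open WellOrder A using (_<_)
  ... | no  none = record
    { _<_ = _<_ ; wellFounded = <-wellFounded ; tri = <-tri ; initial = λ x h → none (x , h) }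
    where open WellOrder A
  ... | yes (x₀ , emb₀) = minimal x₀ emb₀
    where
    open WellOrder A

    EmbedsBelow : Pred A 0ℓ
    EmbedsBelow x = ∃[ h ] (Injective {A = A} _≡_ _≡_ h × (∀ y → h y < x))

    transport : ∀ x → EmbedsBelow x → (∀ {y} → y < x → ¬ EmbedsBelow y) → InitialWellOrder A
    transport x (h , h-inj , h<x) least = record
      { _<_         = _<_ on h
      ; wellFounded = On.wellFounded h <-wellFounded
      ; tri         = λ y z → [ inj₁ , [ inj₂ ∘ inj₁ ∘ h-inj , inj₂ ∘ inj₂ ]′ ]′ (<-tri (h y) (h z))
      ; initial     = λ y (k , k-inj , hk<hy) →
                        least (h<x y) (h ∘ k , k-inj ∘ h-inj , hk<hy)
      }

    minimal : ∀ x → EmbedsBelow x → InitialWellOrder A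
    minimal = All.wfRec <-wellFounded _ _ λ x ih emb → descend x ih emb
      where
      descend : ∀ x → (∀ {y} → y < x → EmbedsBelow y → InitialWellOrder A) →
                EmbedsBelow x → InitialWellOrder A
      descend x ih emb with em {P = ∃[ y ] (y < x × EmbedsBelow y)}
      ... | yes (y , y<x , emb′) = ih y<x emb′
      ... | no  none = transport x emb λ y<x emb′ → none (_ , y<x , emb′)

  abstract
    initialWellOrder : (A : Set) → InitialWellOrder A
    initialWellOrder = transportedWellOrder

  -- Bernstein colourings of families of large sets.

  Large : Set → (Z : Setoid 0ℓ 0ℓ) → Pred (Setoid.Carrier Z) 0ℓ → Set
  Large A Z S = ∃[ h ] (Injective {A = A} _≡_ (Setoid._≈_ Z) h × (∀ x → h x ∈ S))

  -- The recursion can only get stuck at j if the representatives chosen before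
  -- j exhaust K j, and then J embeds below j.
  module Representatives (J : Set) (Z : Setoid 0ℓ 0ℓ) (K : J → Pred (Setoid.Carrier Z) 0ℓ) where
    open Setoid Z using (Carrier; _≈_; sym; trans)
    open InitialWellOrder (initialWellOrder J)

    private
      choose = proj₁ (choice Carrier)
      choose-cong = proj₁ (proj₂ (choice Carrier))
      choose-chosen = proj₂ (proj₂ (choice Carrier))

      Fresh : ∀ j → WfRec _<_ (λ _ → Maybe Carrier) j → Pred Carrier 0ℓ
      Fresh j earlier z = z ∈ K j × (∀ {k} (k<j : k < j) {w} → earlier k<j ≡ just w → ¬ (w ≈ z))

      Fresh-cong : ∀ j {e e′ : WfRec _<_ (λ _ → Maybe Carrier) j} →
                   (∀ {k} (k<j : k < j) → e k<j ≡ e′ k<j) → Fresh j e ⊆ Fresh j e′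
      Fresh-cong j e≡e′ (z∈K , fresh) = z∈K , λ k<j eq → fresh k<j (≡.trans (e≡e′ k<j) eq)

      module Recursion = FixPoint wellFounded (λ _ → Maybe Carrier) (λ j e → choose (Fresh j e))
        -- Pointwise equal histories have coextensive `Fresh` sets, on which `choose` agrees; this
        -- justifies the unfolding equation.
        (λ j e≡e′ → choose-cong
          (Fresh-cong j e≡e′ , Fresh-cong j (λ k<j → ≡.sym (e≡e′ k<j))))

    select : J → Maybe Carrier
    select = All.wfRec wellFounded 0ℓ (λ _ → Maybe Carrier) (λ j e → choose (Fresh j e))

    private
      Available : J → Pred Carrier 0ℓ
      Available j = Fresh j (λ {k} _ → select k)

      select-chosen : ∀ j → Chosen (Available j) (select j)
      select-chosen j =
        subst (Chosen (Available j)) (≡.sym Recursion.unfold-wfRec) (choose-chosen (Available j))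

      select-available : ∀ {j z} → select j ≡ just z → z ∈ Available j
      select-available {j} eq = subst (Chosen (Available j)) eq (select-chosen j)

    select-∈ : ∀ {j z} → select j ≡ just z → z ∈ K j
    select-∈ eq = proj₁ (select-available eq)

    select-injective : ∀ {j k z w} → select j ≡ just z → select k ≡ just w → z ≈ w → j ≡ k
    select-injective {j} {k} j↦z k↦w z≈w with tri j k
    ... | inj₁ j<k        = contradiction z≈w (proj₂ (select-available k↦w) j<k j↦z)
    ... | inj₂ (inj₁ j≡k) = j≡k
    ... | inj₂ (inj₂ k<j) = contradiction (sym z≈w) (proj₂ (select-available j↦z) k<j k↦w)

    select-defined : ∀ j → Large J Z (K j) → ∃[ z ] select j ≡ just z
    select-defined j (h , h-inj , h∈K) with select j | select-chosen j
    ... | just z  | _    = z , refl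
    ... | nothing | none = contradiction (proj₁ ∘ used , used-injective , proj₁ ∘ proj₂ ∘ used) (initial j)
      where
      used : ∀ x → ∃[ k ] (k < j × ∃[ w ] (select k ≡ just w × w ≈ h x))
      used x = stable λ unused → none
        (h x , h∈K x , λ {k} k<j {w} eq w≈hx → unused (k , k<j , w , eq , w≈hx))

      used-injective : Injective _≡_ _≡_ (proj₁ ∘ used)
      used-injective {x} {y} k≡k′ with used x | used y
      ... | k , _ , w , k↦w , w≈hx | k′ , _ , w′ , k′↦w′ , w′≈hy
        with refl ← k≡k′
        with refl ← just-injective (≡.trans (≡.sym k↦w) k′↦w′)
        = h-inj (trans (sym w≈hx) w′≈hy)

  module Bernstein (I : Set) (Z : Setoid 0ℓ 0ℓ) (K : I → Pred (Setoid.Carrier Z) 0ℓ) where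
    open Setoid Z using (Carrier; _≈_; sym; trans) renaming (refl to ≈-refl)
    open Representatives (I × Bool) Z (K ∘ proj₁)

    private
      Hit : Pred Carrier 0ℓ
      Hit z = ∃[ i ] ∃[ w ] (select (i , true) ≡ just w × w ≈ z)

    colour : Carrier → Bool
    colour z = ⌊ Hit z ⌋

    colour-cong : ∀ {x y} → x ≈ y → colour x ≡ colour y
    colour-cong x≈y = ⇔→≡ (mk⇔ (recolour x≈y) (recolour (sym x≈y)))
      where
      recolour : ∀ {x y} → x ≈ y → colour x ≡ true → colour y ≡ true
      recolour x≈y x-hit = let i , w , eq , w≈x = ⌊⌋-sound x-hit in
        ⌊⌋-complete (i , w , eq , trans w≈x x≈y)

    -- The index `(i , true)` selects a hit. The point selected at `(i , false)` is no hit, since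
    -- selection is injective and the Boolean components differ.
    bichromatic : ∀ i → Large (I × Bool) Z (K i) → ∀ b → ∃[ z ] (z ∈ K i × colour z ≡ b)
    bichromatic i large true = let z , eq = select-defined (i , true) large in
      z , select-∈ eq , ⌊⌋-complete (i , z , eq , ≈-refl)
    bichromatic i large false = let z , eq = select-defined (i , false) large in
      z , select-∈ eq , ¬-not λ hit → let i′ , w , eq′ , w≈z = ⌊⌋-sound hit in
        contradiction (,-injectiveʳ (select-injective eq′ eq w≈z)) λ ()

  -- An independent family of subsets of ω.

  module Cantor = Quotient (ℕ →-setoid Bool)
  open Cantor using (rep) renaming (Quotient to 2^ω)

  module PowerCantor = Quotient (2^ω →-setoid Bool)
  open PowerCantor using () renaming (Quotient to 2^2^ω)

  private
    _◂_ : Bool → List (List Bool) → List (List Bool)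
    b ◂ []      = (b ∷ []) ∷ []
    b ◂ (w ∷ d) = (b ∷ w) ∷ d

    -- Reads bijective binary digits as a prefix code: `2[1+_]` ends a word, while `1+[2_]` and the
    -- digit after it form one letter. A dangling `1+[2_]` yields the default `[]`.
    parse : ℕᵇ → List (List Bool)
    parse ℕᵇ.zero           = []
    parse 2[1+ n ]          = [] ∷ parse n
    parse 1+[2 ℕᵇ.zero ]    = []
    parse 1+[2 2[1+ n ] ]   = false ◂ parse n
    parse 1+[2 1+[2 n ] ]   = true ◂ parse n

    unparseWord : List Bool → ℕᵇ → ℕᵇ
    unparseWord []          n = 2[1+ n ]
    unparseWord (false ∷ w) n = 1+[2 2[1+ unparseWord w n ] ]
    unparseWord (true ∷ w)  n = 1+[2 1+[2 unparseWord w n ] ]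

    unparse : List (List Bool) → ℕᵇ
    unparse = foldr unparseWord ℕᵇ.zero

    parse-unparseWord : ∀ w n → parse (unparseWord w n) ≡ w ∷ parse n
    parse-unparseWord []          n = refl
    parse-unparseWord (false ∷ w) n = cong (false ◂_) (parse-unparseWord w n)
    parse-unparseWord (true ∷ w)  n = cong (true ◂_) (parse-unparseWord w n)

    parse-unparse : ∀ d → parse (unparse d) ≡ d
    parse-unparse []      = refl
    parse-unparse (w ∷ d) =
      ≡.trans (parse-unparseWord w (unparse d)) (cong (w ∷_) (parse-unparse d))

  decode : ℕ → List (List Bool)
  decode = parse ∘ ℕᵇ.fromℕ

  decode-surjective : ∀ d → ∃[ n ] decode n ≡ d
  decode-surjective d = ℕᵇ.toℕ (unparse d) ,
    ≡.trans (cong parse (ℕᵇ.fromℕ-toℕ (unparse d))) (parse-unparse d)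

  Captures : List (List Bool) → Pred 2^ω 0ℓ
  Captures d c = ∃[ n ] applyUpTo (rep c) n ∈ₗ d

  -- Hausdorff's independent family: a number codes a finite set of finite words,
  -- and belongs to the set indexed by c if one of the words is a prefix of c.
  independent : 2^ω → ℕ → Bool
  independent c n = ⌊ Captures (decode n) c ⌋

  private
    applyUpTo-≡ : ∀ {f g : ℕ → Bool} n m → applyUpTo f n ≡ applyUpTo g m →
                  ∀ {i} → i ℕ.< n → f i ≡ g i
    applyUpTo-≡ (suc n) (suc m) eq {zero}  _         = List.∷-injectiveˡ eq
    applyUpTo-≡ (suc n) (suc m) eq {suc i} (s≤s i<n) =
      applyUpTo-≡ n m (List.∷-injectiveʳ eq) i<n

    -- Takes a length beyond one place of difference for each member other than `c`; the prefix of
    -- `c` of that length then belongs to none of them.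
    separate : ∀ c cs → ∃[ n ] (∀ {c′} → c′ ∈ₗ cs → c ≢ c′ → ∃[ i ] (i ℕ.< n × rep c i ≢ rep c′ i))
    separate c [] = 0 , λ ()
    separate c (c₀ ∷ cs) with separate c cs | em {P = c ≡ c₀}
    ... | n , sep | yes c≡c₀ = n , λ { (here refl)  c≢c₀ → contradiction c≡c₀ c≢c₀
                                     ; (there c′∈cs)     → sep c′∈cs }
    ... | n , sep | no c≢c₀ with ¬∀⇒∃¬ (c≢c₀ ∘ Cantor.rep-injective)
    ...   | k , ck≢ = n ⊔ suc k , λ
      { (here refl)  _    → k , m≤n⊔m n (suc k) , ck≢
      ; (there c′∈cs) c≢c′ → let i , i<n , ci≢ = sep c′∈cs c≢c′ in
                             i , ≤-trans i<n (m≤m⊔n n (suc k)) , ci≢ }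

    -- Collects, for every `c` in `cs` with value `true`, a prefix long enough to rule out the other
    -- members of `avoid`. Two lists are used so that `avoid` stays fixed while `cs` shrinks.
    capture : ∀ (g : 2^ω → Bool) (avoid cs : List 2^ω) →
              ∃[ d ] ((∀ {c} → c ∈ₗ cs → g c ≡ true → Captures d c) ×
                      (∀ {c} → c ∈ₗ avoid → g c ≡ false → ¬ Captures d c))
    capture g avoid [] = [] , (λ ()) , λ _ _ ()
    capture g avoid (c ∷ cs) with capture g avoid cs | g c in gc
    ... | d , captured , avoided | false = d ,
      (λ { (here refl) gc≡true → contradiction (≡.trans (≡.sym gc) gc≡true) λ ()
         ; (there c′∈) → captured c′∈ }) , avoided
    ... | d , captured , avoided | true with separate c avoid
    ...   | n , sep = applyUpTo (rep c) n ∷ d ,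
      (λ { (here refl) _ → n , here refl
         ; (there c′∈) gc′ → let m , ∈d = captured c′∈ gc′ in m , there ∈d }) ,
      λ { c′∈ gc′ (m , here eq) →
            let i , i<n , ci≢ = sep c′∈ λ { refl → contradiction (≡.trans (≡.sym gc) gc′) λ () }
            in ci≢ (applyUpTo-≡ n m (≡.sym eq) i<n)
        ; c′∈ gc′ (m , there ∈d) → avoided c′∈ gc′ (m , ∈d) }

  independence : ∀ (g : 2^ω → Bool) cs → ∃[ n ] (∀ {c} → c ∈ₗ cs → independent c n ≡ g c)
  independence g cs with capture g cs cs
  ... | d , captured , avoided with decode-surjective d
  ...   | n , refl = n , λ c∈ → agree c∈
    where
    agree : ∀ {c} → c ∈ₗ cs → independent c n ≡ g c
    agree {c} c∈ with g c in gc
    ... | true  = ⌊⌋-complete (captured c∈ gc)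
    ... | false = ¬-not λ eq → avoided c∈ gc (⌊⌋-sound eq)

  -- Infinite compact sets of ultrafilters realise all patterns.

  -- A subspace of βω, its points seen as ultrafilters on ω.
  record UltrafilterSet (Y : Setoid a a) : Set (Level.suc 0ℓ ⊔ₗ a) where
    open Setoid Y using (Carrier; _≈_)
    field
      contains  : (ℕ → Bool) → Carrier → Bool
      -- Density of ω in pointwise form: Boolean identities between up to three sets pass from ω to
      -- `y`.
      trace     : ∀ A B C y → ∃[ n ]
                  (A n ≡ contains A y × B n ≡ contains B y × C n ≡ contains C y)
      separates : ∀ {x y} → ¬ (x ≈ y) → ∃[ A ] contains A x ≢ contains A y
      compact   : ∀ {I : Set} (A : I → ℕ → Bool) (b : I → Bool) →
                  (∀ y → ∃[ i ] contains (A i) y ≡ b i) →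
                  ∃[ is ] (∀ y → Any (λ i → contains (A i) y ≡ b i) is)
      infinite  : ¬ (∃[ ys ] (∀ y → Any (y ≈_) ys))

    contains-∧ : ∀ A B y → contains (λ n → A n ∧ B n) y ≡ contains A y ∧ contains B y
    contains-∧ A B y = let n , a , b , c = trace A B (λ n → A n ∧ B n) y in
      ≡.trans (≡.sym c) (≡.cong₂ _∧_ a b)

    contains-not : ∀ A y → contains (not ∘ A) y ≡ not (contains A y)
    contains-not A y = let n , a , b , _ = trace A (not ∘ A) A y in
      ≡.trans (≡.sym b) (cong not a)

    contains-⊤ : ∀ y → contains (λ _ → true) y ≡ true
    contains-⊤ y = ≡.sym (proj₁ (proj₂ (trace _ (λ _ → true) (λ _ → true) y)))

    Thick : Pred (ℕ → Bool) a
    Thick A = ¬ (∃[ ys ] (∀ y → contains A y ≡ true → Any (y ≈_) ys))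

    Shrinking : Pred (ℕ → Bool) a
    Shrinking A = ∃[ A′ ] (Thick A′ × (∀ n → A′ n ≡ true → A n ≡ true) ×
                  ∃[ y ] (contains A y ≡ true × contains A′ y ≡ false))

    -- Of the two parts into which `D` cuts `A`, one is infinite and is kept; whichever of `x` and
    -- `y` lies in the other part is the point split off.
    halve : ∀ {A x y} D → Thick A → contains A x ≡ true → contains A y ≡ true →
            contains D x ≡ true → contains D y ≡ false → Shrinking A
    halve {A} {x} {y} D thick x∈A y∈A x∈D y∉D with em {P = Thick (λ n → A n ∧ D n)}
    ... | yes A∧D-thick = (λ n → A n ∧ D n) , A∧D-thick , (λ n → ∧-conicalˡ (A n) (D n)) , y , y∈A ,
      ≡.trans (contains-∧ A D y) (≡.cong₂ _∧_ y∈A y∉D)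
    ... | no  A∧D-thin = (λ n → A n ∧ not (D n)) , A∖D-thick , (λ n → ∧-conicalˡ (A n) (not (D n))) ,
      x , x∈A , ≡.trans (contains-∧ A (not ∘ D) x)
                  (≡.cong₂ _∧_ x∈A (≡.trans (contains-not D x) (cong not x∈D)))
      where
      A∖D-thick : Thick (λ n → A n ∧ not (D n))
      A∖D-thick (ys , A∖D⊆ys) = A∧D-thin λ (xs , A∧D⊆xs) → thick (xs ++ ys , cover xs A∧D⊆xs)
        where
        cover : ∀ xs → (∀ z → contains (λ n → A n ∧ D n) z ≡ true → Any (z ≈_) xs) →
                ∀ z → contains A z ≡ true → Any (z ≈_) (xs ++ ys)
        cover xs A∧D⊆xs z z∈A with contains D z in Dz
        ... | true  = Any.++⁺ˡ (A∧D⊆xs z (≡.trans (contains-∧ A D z) (≡.cong₂ _∧_ z∈A Dz)))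
        ... | false = Any.++⁺ʳ xs (A∖D⊆ys z (≡.trans (contains-∧ A (not ∘ D) z)
                        (≡.cong₂ _∧_ z∈A (≡.trans (contains-not D z) (cong not Dz)))))

    -- There are two distinct points, as otherwise the empty list or a singleton would enumerate the
    -- set; a set separating them makes the cut.
    shrink : ∀ A → Thick A → Shrinking A
    shrink A thick
      with x , x∈A ← stable {P = ∃[ x ] contains A x ≡ true}
             (λ none → thick ([] , λ y y∈A → contradiction (y , y∈A) none))
      with y , y∈A , y≉x ← stable {P = ∃[ y ] (contains A y ≡ true × ¬ (y ≈ x))}
             (λ none → thick (x ∷ [] , λ y y∈A → here (stable λ y≉x → none (y , y∈A , y≉x))))
      with D , Dy≢Dx ← separates y≉x
      with contains D x in Dx | contains D y in Dy
    ... | true  | false = halve D thick x∈A y∈A Dx Dy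
    ... | false | true  = halve D thick y∈A x∈A Dy Dx
    ... | true  | true  = contradiction refl Dy≢Dx
    ... | false | false = contradiction refl Dy≢Dx

    private
      chain : ℕ → ∃ Thick
      chain zero    = (λ _ → true) , λ (ys , cover) → infinite (ys , λ y → cover y (contains-⊤ y))
      chain (suc n) = let A , thick = chain n ; A′ , thick′ , _ = shrink A thick in A′ , thick′

      shrinking : ∀ n → Shrinking (proj₁ (chain n))
      shrinking n = shrink (proj₁ (chain n)) (proj₂ (chain n))

      abstract
        level : ℕ → ℕ → Bool
        level n = proj₁ (chain n)

        point : ℕ → Carrier
        point n = proj₁ (proj₂ (proj₂ (proj₂ (shrinking n))))

        level-suc : ∀ n i → level (suc n) i ≡ true → level n i ≡ true
        level-suc n = proj₁ (proj₂ (proj₂ (shrinking n)))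

        point-inside : ∀ n → contains (level n) (point n) ≡ true
        point-inside n = proj₁ (proj₂ (proj₂ (proj₂ (proj₂ (shrinking n)))))

        point-outside : ∀ n → contains (level (suc n)) (point n) ≡ false
        point-outside n = proj₂ (proj₂ (proj₂ (proj₂ (proj₂ (shrinking n)))))

      level-antitone : ∀ {m n} → m ≤′ n → ∀ i → level n i ≡ true → level m i ≡ true
      level-antitone ≤′-refl       i eq = eq
      level-antitone (≤′-step m≤n) i eq = level-antitone m≤n i (level-suc _ i eq)

      Layer : ℕ → Pred ℕ 0ℓ
      Layer n i = level n i ≡ true × level (suc n) i ≡ false

      layers-disjoint : ∀ {m n i} → m ℕ.< n → i ∈ Layer m → ¬ (i ∈ Layer n)
      layers-disjoint m<n (_ , ∉) (∈ , _) =
        contradiction (≡.trans (≡.sym ∉) (level-antitone (≤⇒≤′ m<n) _ ∈)) λ ()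

      layer-unique : ∀ {m n i} → i ∈ Layer m → i ∈ Layer n → m ≡ n
      layer-unique {m} {n} i∈m i∈n with <-cmp m n
      ... | tri< m<n _ _ = contradiction i∈n (layers-disjoint m<n i∈m)
      ... | tri≈ _ m≡n _ = m≡n
      ... | tri> _ _ n<m = contradiction i∈m (layers-disjoint n<m i∈n)

    -- The preimage of `independent c` under the map taking a number to the index of its layer;
    -- numbers in no layer are left out.
    spread : 2^ω → ℕ → Bool
    spread c i = ⌊ (∃[ n ] (i ∈ Layer n × independent c n ≡ true)) ⌋

    private
      spread-layer : ∀ c {n i} → i ∈ Layer n → spread c i ≡ independent c n
      spread-layer c {n} {i} i∈n = ⇔→≡ (mk⇔ to (λ eq → ⌊⌋-complete (n , i∈n , eq)))
        where
        to : spread c i ≡ true → independent c n ≡ true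
        to eq with n′ , i∈n′ , ind ← ⌊⌋-sound eq with refl ← layer-unique i∈n i∈n′ = ind

      -- As an ultrafilter, `point n` contains layer `n`, and `spread c` is constant on that layer.
      spread-point : ∀ c n → contains (spread c) (point n) ≡ independent c n
      spread-point c n with trace (level n) (level (suc n)) (spread c) (point n)
      ... | i , l , l′ , s = ≡.trans (≡.sym s)
        (spread-layer c (≡.trans l (point-inside n) , ≡.trans l′ (point-outside n)))

    -- Otherwise the clopen sets of disagreement with `g` cover the space. For a finite subcover,
    -- independence gives an `n` whose `point n` agrees with `g` at every index involved, so it is
    -- uncovered.
    realise : ∀ (g : 2^ω → Bool) → ∃[ y ] (∀ c → contains (spread c) y ≡ g c)
    realise g = stable λ unrealised →
      let cs , cover = compact spread (not ∘ g) λ y →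
            let c , ≢ = ¬∀⇒∃¬ λ all → unrealised (y , all) in c , ¬-not ≢
          n , agree = independence g cs
          c , c∈cs , differ = find (cover (point n))
      in not-¬ (≡.trans (spread-point c n) (agree c∈cs)) differ

-- Clopen subsets of βω.

module StoneČech (βω : StoneČechCompactification ω) where
  open StoneČechCompactification βω using (β; hausdorff; ι; embedding; extend; remainder)
  open Space β using (Carrier; _≈_; Open; open-∩)
  open IsDenseEmbedding embedding using (dense)

  private
    ⟦_⟧ : ℕ → Carrier
    ⟦_⟧ = Func.to ι

    discreteBool : Space 0ℓ 0ℓ
    discreteBool = record
      { setoid        = ≡.setoid Bool
      ; Open          = λ _ → ⊤
      ; open-respects = λ {U} _ → subst U
      ; open-≐        = _
      ; open-⊤        = _
      ; open-∩        = _
      ; open-⋃        = _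
      }

    discreteBool-compact : Compact discreteBool
    discreteBool-compact F _ cover = let i , t = cover true ; j , f = cover false in
      i ∷ j ∷ [] , λ { true → here t ; false → there (here f) }

    discreteBool-hausdorff : Hausdorff discreteBool
    discreteBool-hausdorff {x} {y} x≢y =
      (_≡ x) , (_≡ y) , _ , _ , refl , refl , λ { (refl , x≡y) → x≢y x≡y }

    extension : (A : ℕ → Bool) → _
    extension A = extend discreteBool discreteBool-compact discreteBool-hausdorff
      (record { to = A ; cong = cong A }) _

  -- The characteristic function of the closure of `A` in βω, obtained by extending that of `A`.
  hat : (ℕ → Bool) → Carrier → Bool
  hat A = Func.to (proj₁ (extension A))

  hat-cong : ∀ A {x y} → x ≈ y → hat A x ≡ hat A y
  hat-cong A = Func.cong (proj₁ (extension A))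

  hat-open : ∀ A b → Open (λ x → hat A x ≡ b)
  hat-open A b = proj₁ (proj₂ (extension A)) {_≡ b} _ (id , id)

  hat-ι : ∀ A n → hat A ⟦ n ⟧ ≡ A n
  hat-ι A = proj₂ (proj₂ (extension A))

  -- The points where the three functions take their values at `x` form an open neighbourhood of
  -- `x`, which meets ω by density.
  hat-trace : ∀ A B C x → ∃[ n ] (A n ≡ hat A x × B n ≡ hat B x × C n ≡ hat C x)
  hat-trace A B C x =
    let n , a , b , c = dense (open-∩ (hat-open A _) (open-∩ (hat-open B _) (hat-open C _)))
                              (x , refl , refl , refl)
    in n , ≡.trans (≡.sym (hat-ι A n)) a , ≡.trans (≡.sym (hat-ι B n)) b
         , ≡.trans (≡.sym (hat-ι C n)) c

  hat-≗ : ∀ {A B} → A ≗ B → ∀ x → hat A x ≡ hat B x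
  hat-≗ {A} {B} A≗B x = let n , a , b , _ = hat-trace A B B x in
    ≡.trans (≡.sym a) (≡.trans (A≗B n) b)

  private
    -- The union, over `As`, of whichever of `A` and its complement has a closure missing `z`.
    differs : List (ℕ → Bool) → Carrier → ℕ → Bool
    differs []       z n = false
    differs (A ∷ As) z n = (A n xor hat A z) ∨ differs As z n

    differs-self : ∀ As z → hat (differs As z) z ≡ false
    differs-self [] z = let n , a , _ = hat-trace (differs [] z) (differs [] z) (differs [] z) z in
      ≡.sym a
    differs-self (A ∷ As) z =
      let n , a , b , c = hat-trace A (differs As z) (differs (A ∷ As) z) z in
      ≡.trans (≡.sym c) (≡.cong₂ _∨_
        (≡.trans (cong (_xor hat A z) a) (xor-same (hat A z)))
        (≡.trans b (differs-self As z)))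

    differs-other : ∀ {As z x} → Any (λ A → hat A x ≡ not (hat A z)) As →
                    hat (differs As z) x ≡ true
    differs-other {A ∷ As} {z} {x} any
      with n , a , b , c ← hat-trace A (differs As z) (differs (A ∷ As) z) x =
      ≡.trans (≡.sym c) (differs-at any)
      where
      differs-at : Any (λ A → hat A x ≡ not (hat A z)) (A ∷ As) → differs (A ∷ As) z n ≡ true
      differs-at (here ≢) = cong (_∨ differs As z n) (≡.trans (cong (_xor hat A z) (≡.trans a ≢))
        (≡.trans (≡.sym (not-distribˡ-xor (hat A z) (hat A z))) (cong not (xor-same (hat A z)))))
      differs-at (there rest) = ≡.trans
        (cong ((A n xor hat A z) ∨_) (≡.trans b (differs-other rest))) (∨-zeroʳ (A n xor hat A z))

  -- The colouring of βω and the copies of Y.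

  module Colouring (ac : ∀ {a} → AxiomOfChoice a) where
    open Choice ac
    open Cantor using (rep; rep-[]; rep-injective) renaming (Quotient to 2^ω; [_] to [_]ᶜ)
    open PowerCantor using () renaming
      (Quotient to 2^2^ω; [_] to [_]ᵖ; rep to repᵖ; rep-[] to repᵖ-[];
       rep-injective to repᵖ-injective)

    -- The separating set is the trace on ω of a neighbourhood `U` of `x` disjoint from a
    -- neighbourhood of `y`; density decides both memberships.
    hat-separates : ∀ {x y} → ¬ (x ≈ y) → ∃[ A ] hat A x ≢ hat A y
    hat-separates {x} {y} x≉y with U , V , oU , oV , x∈U , y∈V , U⊥V ← hausdorff x≉y =
      A , λ eq → contradiction (≡.trans (≡.sym Ax) (≡.trans eq Ay)) λ ()
      where
      A : ℕ → Bool
      A n = ⌊ U ⟦ n ⟧ ⌋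

      Ax : hat A x ≡ true
      Ax = ¬-not λ x∉A →
        let n , n∈U , n∉A = dense (open-∩ oU (hat-open A false)) (x , x∈U , x∉A)
        in ⌊⌋-unsound (≡.trans (≡.sym (hat-ι A n)) n∉A) n∈U

      Ay : hat A y ≡ false
      Ay = ¬-not λ y∈A →
        let n , n∈V , n∈A = dense (open-∩ oV (hat-open A true)) (y , y∈V , y∈A)
        in U⊥V (⌊⌋-sound (≡.trans (≡.sym (hat-ι A n)) n∈A) , n∈V)

    -- Every closed set is the intersection of the clopen sets containing it.
    Closed : 2^2^ω → Pred Carrier 0ℓ
    Closed q x = ∀ c → repᵖ q c ≡ true → hat (rep c) x ≡ true

    open Bernstein 2^2^ω (Space.setoid β) Closed public

    private
      -- Codes a family and a bit as one pattern on `2^ω`: sequences starting with `true` carry the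
      -- bit, the others carry the family at their tails. Thus `realise` also supplies the factor
      -- `Bool`.
      pair : 2^2^ω × Bool → 2^ω → Bool
      pair (q , b) c = if rep c 0 then b else repᵖ q [ rep c ∘ suc ]ᶜ

      _∷ω_ : Bool → (ℕ → Bool) → ℕ → Bool
      (b ∷ω f) zero    = b
      (b ∷ω f) (suc n) = f n

      pair-true : ∀ p → pair p [ (λ _ → true) ]ᶜ ≡ proj₂ p
      pair-true p rewrite rep-[] (λ _ → true) 0 = refl

      pair-false : ∀ p c → pair p [ false ∷ω rep c ]ᶜ ≡ repᵖ (proj₁ p) c
      pair-false p c rewrite rep-[] (false ∷ω rep c) 0 = cong (repᵖ (proj₁ p))
        (rep-injective λ n → ≡.trans (rep-[] _ n) (rep-[] (false ∷ω rep c) (suc n)))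

      pair-injective : ∀ {p p′} → pair p ≗ pair p′ → p ≡ p′
      pair-injective {p} {p′} eq = ≡.cong₂ _,_
        (repᵖ-injective λ c →
          ≡.trans (≡.sym (pair-false p c)) (≡.trans (eq [ false ∷ω rep c ]ᶜ) (pair-false p′ c)))
        (≡.trans (≡.sym (pair-true p)) (≡.trans (eq [ (λ _ → true) ]ᶜ) (pair-true p′)))

    module Copy {ℓ o} (Y : Space ℓ o) (Y-compact : Compact Y) (Y-infinite : Infinite Y)
                (S : Subset remainder) (homeo : Homeomorphism (subspace remainder S) Y) where
      module Y = Space Y
      open Homeomorphism homeo using (from; from-continuous; strictlyInverseˡ; to-cong)

      embed : Y.Carrier → Carrier
      embed y = proj₁ (proj₁ (from y))

      embed-injective : ∀ {x y} → embed x ≈ embed y → x Y.≈ y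
      embed-injective {x} {y} eq =
        Y.trans (Y.sym (strictlyInverseˡ x)) (Y.trans (to-cong eq) (strictlyInverseˡ y))

      clopen : ∀ A b → Y.Open (λ y → Lift ℓ (hat A (embed y) ≡ b))
      clopen A b = from-continuous
        ((λ z → hat A (proj₁ z) ≡ b) , ((λ z → hat A z ≡ b) , hat-open A b , id , id) , id , id)
        (lower , lift)

      ultrafilters : UltrafilterSet Y.setoid
      ultrafilters = record
        { contains  = λ A y → hat A (embed y)
        ; trace     = λ A B C y → hat-trace A B C (embed y)
        ; separates = λ x≉y → hat-separates (x≉y ∘ embed-injective)
        ; compact   = λ A b cover →
            let is , finite = Y-compact (λ i y → Lift ℓ (hat (A (lower i)) (embed y) ≡ b (lower i)))
                                (λ i → clopen (A (lower i)) (b (lower i)))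
                                (λ y → let i , eq = cover y in lift i , lift eq)
            in map lower is , λ y → Any.map⁺ (Any.map lower (finite y))
        ; infinite  = Y-infinite
        }
      open UltrafilterSet ultrafilters using (compact; realise; spread)

      -- The filter of all subsets of ω whose closures contain the whole copy.
      code : 2^2^ω
      code = [ (λ c → ⌊ (∀ y → hat (rep c) (embed y) ≡ true) ⌋) ]ᵖ

      embed∈code : ∀ y → embed y ∈ Closed code
      embed∈code y c eq = ⌊⌋-sound (≡.trans (≡.sym (repᵖ-[] _ c)) eq) y

      -- The copy is compact, hence closed: for `z` outside it, finitely many separating clopen sets
      -- cover the copy, and their union belongs to the filter but misses `z`.
      code⊆image : ∀ {z} → z ∈ Closed code → ∃[ y ] embed y ≈ z
      code⊆image {z} z∈code = stable λ z∉image →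
        let As , finite = compact id (λ A → not (hat A z)) λ y →
              let A , ≢ = hat-separates (λ y≈z → z∉image (y , y≈z)) in A , ¬-not ≢
            U = differs As z
            U⊇image = λ y → ≡.trans (hat-≗ (rep-[] U) (embed y)) (differs-other {As} (finite y))
            z∈U = z∈code [ U ]ᶜ (≡.trans (repᵖ-[] _ [ U ]ᶜ) (⌊⌋-complete U⊇image))
        in not-¬ (≡.trans (≡.sym (hat-≗ (rep-[] U) z)) z∈U) (differs-self As z)

      -- A realising point determines its pattern through the sets `spread c`, so distinct pairs
      -- yield distinct points of the copy.
      large : Large (2^2^ω × Bool) (Space.setoid β) (Closed code)
      large = (λ p → embed (proj₁ (realise (pair p))))
            , (λ {p} {p′} eq → pair-injective λ c →
                ≡.trans (≡.sym (proj₂ (realise (pair p)) c))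
                  (≡.trans (hat-cong (spread c) eq) (proj₂ (realise (pair p′)) c)))
            , (λ p → embed∈code _)

      coloured : ∀ b → ∃[ y ] colour (embed y) ≡ b
      coloured b =
        let z , z∈code , eq = bichromatic code large b
            y , y≈z = code⊆image z∈code
        in y , ≡.trans (colour-cong y≈z) eq

corollary2p3 : (∀ {a} → AxiomOfChoice a) →
    (βω : StoneČechCompactification ω) →
    ∀ {ℓ o} (Y : Space ℓ o) → Compact Y → Infinite Y →
    ¬ (StoneČechCompactification.remainder βω ⟶⟨ Y ⟩¹₂)
corollary2p3 ac βω Y Y-compact Y-infinite arrow =
  let i , S , S⊆Pi , homeo = arrow P covers
      open Copy Y Y-compact Y-infinite S homeo using (coloured)
      -- The copy lies in the colour class of `i`, so a point of the opposite colour is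
      -- contradictory.
      y , eq = coloured (not (bit i))
  in not-¬ (S⊆Pi (proj₂ (Homeomorphism.from homeo y))) eq
  where
  open StoneČech βω
  open StoneČechCompactification βω using (β; remainder)

  open Colouring ac

  bit : Fin 2 → Bool
  bit zero    = false
  bit (suc _) = true

  P : Fin 2 → Subset remainder
  P i = record
    { pred     = λ x → colour (proj₁ x) ≡ bit i
    ; respects = λ x≈y eq → ≡.trans (≡.sym (colour-cong x≈y)) eq
    }

  covers : ∀ x → ∃[ i ] Subset.pred (P i) x
  covers x with colour (proj₁ x)
  ... | false = zero , refl
  ... | true  = suc zero , refl
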